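{- Let $\epsilon$ be a valuation, $\mathbf p,\mathbf p_1,\mathbf p_2$ expectation lower bounds (functions from valuations to $[0,1]$), $s$ a pGCL program, and $\varphi_1,\varphi_2$ well-formed pDL formulae. Then: 1. (p-box conjunction) If $\epsilon\models[s]_{\mathbf p_1}\,\varphi_1$ and $\epsilon\models[s]_{\mathbf p_2}\,\varphi_2$, then $\epsilon\models[s]_{\mathbf p}\,(\varphi_1\wedge\varphi_2)$, where $\mathbf p=\max(\mathbf p_1+\mathbf p_2-1,\,0)$ everywhere. 2. (p-box disjunction) If $\epsilon\models[s]_{\mathbf p_1}\,\varphi_1$ or $\epsilon\models[s]_{\mathbf p_2}\,\varphi_2$, then $\epsilon\models[s]_{\mathbf p}\,(\varphi_1\vee\varphi_2)$, where $\mathbf p=\min(\mathbf p_1,\mathbf p_2)$ everywhere.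
   Context: **Programs (pGCL).** Fix a set $X$ of program variables. Expressions $e$ are built from program variables and primitive values (Booleans, numbers, ...) with the usual unary/binary arithmetic, comparison and logical operators; they are assumed well-formed, and $\epsilon(e)$ denotes the value of $e$ in a valuation $\epsilon$ (a map from program variables to values). Programs are $$s ::= s\sqcap s \mid s\,{}_{e}\!\oplus s\mid s;s\mid \mathtt{skip}\mid x:=e\mid \mathtt{if}\ e\ \{s\}\ \mathtt{else}\ \{s\}\mid\mathtt{while}\ e\ \{s\},$$ where $\sqcap$ is demonic (non-deterministic) choice and ${}_e\oplus$ is probabilistic choice (left branch with probability given by the value of $e$). **MDP semantics.** A program $s$ denotes a Markov decision process $\mathcal M_s$ with states $\langle\epsilon,s'\rangle$ (valuation, program). A positional policy $\pi$ maps states to available actions; the only states with more than one action are those where a demonic choice is to be resolved, and $\pi\langle\epsilon,s_1\sqcap s_2\rangle\in\{s_1,s_2\}$. For a policy $\pi$, the probabilistic transitions $\sigma\xrightarrow{p}_\pi\sigma'$ are given by the rules: - $\langle\epsilon,x:=e\rangle\xrightarrow{1}_\pi\langle\epsilon[x\mapsto\epsilon(e)],\mathtt{skip}\rangle$; - if $\epsilon(e)=p\in[0,1]$: $\langle\epsilon,s_1\,{}_e\!\oplus s_2\rangle\xrightarrow{p}_\pi\langle\epsilon,s_1\rangle$ and $\langle\epsilon,s_1\,{}_e\!\oplus s_2\rangle\xrightarrow{1-p}_\pi\langle\epsilon,s_2\rangle$ (probabilities are added if the targets coincide); - if $\pi\langle\epsilon,s_1\sqcap s_2\rangle=s_i$: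 $\langle\epsilon,s_1\sqcap s_2\rangle\xrightarrow{1}_\pi\langle\epsilon,s_i\rangle$; - if $\langle\epsilon,s_1\rangle\xrightarrow{p}_\pi\langle\epsilon',s_2\rangle$: $\langle\epsilon,\mathtt{skip};s_1\rangle\xrightarrow{p}_\pi\langle\epsilon',s_2\rangle$ and $\langle\epsilon,s_1;s\rangle\xrightarrow{p}_\pi\langle\epsilon',s_2;s\rangle$; - $\langle\epsilon,\mathtt{if}\ e\ \{s_1\}\ \mathtt{else}\ \{s_2\}\rangle\xrightarrow{1}_\pi\langle\epsilon,s_1\rangle$ if $\epsilon(e)=\mathit{true}$, and $\xrightarrow{1}_\pi\langle\epsilon,s_2\rangle$ if $\epsilon(e)=\mathit{false}$; - $\langle\epsilon,\mathtt{while}\ e\ \{s\}\rangle\xrightarrow{1}_\pi\langle\epsilon,s;\mathtt{while}\ e\ \{s\}\rangle$ if $\epsilon(e)=\mathit{true}$, and $\xrightarrow{1}_\pi\langle\epsilon,\mathtt{skip}\rangle$ if $\epsilon(e)=\mathit{false}$. A state is final if it has no transitions; the state $\langle\epsilon,\mathtt{skip}\rangle$ is final. Standing assumption: every program considered (every program occurring inside a box) reaches, from every initial valuation and under every policy, a state of the form $\langle\epsilon',\mathtt{skip}\rangle$ with probability $1$. **Expectations.** A path is a finite sequence of states $\sigma_1,\dots,\sigma_n$ with consecutive positive-probability transitions under $\pi$ ending in a final state $\mathrm{final}(\overline\sigma)=\sigma_n$; $\Pr(\overline\sigma)$ is the product of its transition probabilities (equal to $1$ for a one-state path), and $\mathrm{paths}_\pi(\sigma)$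 is the set of paths from $\sigma$. For a reward $r$ with values in $[0,1]$ on final states, $$\mathbb E_{\sigma,\pi}\,r=\sum_{\overline\sigma\in\mathrm{paths}_\pi(\sigma)}\Pr(\overline\sigma)\,r(\mathrm{final}(\overline\sigma)),\qquad \mathbf E_\sigma\,r=\inf_\pi\mathbb E_{\sigma,\pi}\,r .$$ A function of valuations is regarded as a reward by evaluating it on the valuation of the final state. **Logic (pDL).** Let $L$ be a set of logical variables disjoint from $X$; each $l\in L$ has a domain $\mathrm{dom}\,l$ of values. Formulae are $$\varphi::=\text{atomic formula}\mid\neg\varphi\mid\varphi_1\wedge\varphi_2\mid\forall l\cdot\varphi\mid[s]_{\mathbf p}\,\varphi,$$ where atomic formulae are built from constants, program variables and logical variables, $s$ is a pGCL program (it mentions no logical variables), and $\mathbf p$ is an expectation lower bound, i.e. a function from valuations of program variables to $[0,1]$. $\to,\vee,\exists$ are derived as usual. A formula is well-formed if it has no free logical variables. Satisfaction $\epsilon\models\varphi$ is defined by: standard satisfaction for atomic formulae; the classical clauses for $\neg,\wedge$; $\epsilon\models\forall l\cdot\varphi$ iff $\epsilon\models\varphi[l:=v]$ for each $v\in\mathrm{dom}\,l$; and $$\epsilon\models[s]_{\mathbf p}\,\varphi\quad\text{iff}\quad \mathbf p(\epsilon)\le\mathbf E_{\langle\epsilon,s\rangle}[\![\varphi]\!]\ \text{ in }\mathcal M_s,$$ where $[\![\varphi]\!](\epsilon')=1$ if $\epsilon'\models\varphi$ and $0$ otherwise. -}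

module Defs where

open import Algebra.Structures using (IsCommutativeRing)
import Algebra.Construct.NaturalChoice.Max as Max
import Algebra.Construct.NaturalChoice.Min as Min
open import Axiom.ExcludedMiddle using (ExcludedMiddle)
open import Data.Bool.Base using (Bool; true; false; if_then_else_)
open import Data.List.Base using (List; []; _∷_; map; foldr)
open import Data.List.Membership.Propositional using (_∈_)
open import Data.List.Relation.Unary.All using (All; []; _∷_)
  renaming (lookup to lookupAll)
open import Data.List.Relation.Unary.Unique.Propositional using (Unique)
open import Data.Product.Base using (_×_; _,_; proj₁; proj₂; ∃; ∃-syntax)
open import Data.Sum.Base using (_⊎_)
open import Data.Unit.Base using (⊤)
open import Level using (0ℓ)
open import Relation.Binary.Bundles using (TotalOrder)
open import Relation.Binary.PropositionalEquality using (_≡_; _≢_; refl)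
open import Relation.Binary.Structures using (IsTotalOrder)
open import Relation.Nullary using (¬_; yes; no; does)

-- The real numbers, characterised up to isomorphism as a Dedekind-complete
-- ordered field.  The value of ⨆ is only specified on inhabited sets that are
-- bounded above.

record CompleteOrderedField : Set₁ where
  infix  8 -_
  infixl 7 _*_
  infixl 6 _+_ _-_
  infix  4 _≤_ _<_
  field
    ℝ     : Set
    _+_   : ℝ → ℝ → ℝ
    _*_   : ℝ → ℝ → ℝ
    -_    : ℝ → ℝ
    0# 1# : ℝ
    _≤_   : ℝ → ℝ → Set
    ⨆     : (ℝ → Set) → ℝ

  UpperBound : (ℝ → Set) → ℝ → Set
  UpperBound S b = ∀ x → S x → x ≤ b

  field
    isCommutativeRing : IsCommutativeRing _≡_ _+_ _*_ -_ 0# 1#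
    0≢1               : 0# ≢ 1#
    invertible        : ∀ x → x ≢ 0# → ∃[ y ] x * y ≡ 1#
    isTotalOrder      : IsTotalOrder _≡_ _≤_
    +-monoʳ-≤         : ∀ x {y z} → y ≤ z → x + y ≤ x + z
    *-nonNegative     : ∀ {x y} → 0# ≤ x → 0# ≤ y → 0# ≤ x * y
    ⨆-upper           : ∀ S → ∃ (UpperBound S) → UpperBound S (⨆ S)
    ⨆-least           : ∀ S → ∃ S → ∀ b → UpperBound S b → ⨆ S ≤ b

  _-_ : ℝ → ℝ → ℝ
  x - y = x + - y

  _<_ : ℝ → ℝ → Set
  x < y = x ≤ y × x ≢ y

  ⨅ : (ℝ → Set) → ℝ
  ⨅ S = - ⨆ (λ x → S (- x))

  sum : List ℝ → ℝ
  sum = foldr _+_ 0#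

  totalOrder : TotalOrder 0ℓ 0ℓ 0ℓ
  totalOrder = record { isTotalOrder = isTotalOrder }

  open Max totalOrder public using () renaming (_⊔_ to max)
  open Min totalOrder public using () renaming (_⊓_ to min)

-- Well-formedness of expressions is enforced by typing.  Besides Booleans and
-- numbers there may be further primitive types, and the operators are arbitrary
-- total functions on the primitive values.

data Type (Base : Set) : Set where
  bool num : Type Base
  base     : Base → Type Base

module _ (ℝ : Set) {Base : Set} (⟦_⟧ᵇ : Base → Set) where

  PrimitiveValue : Type Base → Set
  PrimitiveValue bool     = Bool
  PrimitiveValue num      = ℝ
  PrimitiveValue (base b) = ⟦ b ⟧ᵇ

record Signature (ℝ : Set) : Set₁ where
  field
    Base  : Set
    ⟦_⟧ᵇ  : Base → Set

  Ty : Set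
  Ty = Type Base

  Value : Ty → Set
  Value = PrimitiveValue ℝ ⟦_⟧ᵇ

  field
    Op₁   : Ty → Ty → Set
    Op₂   : Ty → Ty → Ty → Set
    ⟦_⟧₁  : ∀ {a b} → Op₁ a b → Value a → Value b
    ⟦_⟧₂  : ∀ {a b c} → Op₂ a b c → Value a → Value b → Value c
    X     : Set
    typeX : X → Ty
    L     : Set
    typeL : L → Ty
    dom   : (l : L) → Value (typeL l) → Set

module pDL (em : ExcludedMiddle 0ℓ) (R : CompleteOrderedField)
           (S : Signature (CompleteOrderedField.ℝ R)) where

  open CompleteOrderedField R
  open Signature S

  Valuation : Set
  Valuation = (x : X) → Value (typeX x)

  _[_↦_] : Valuation → (x : X) → Value (typeX x) → Valuation
  (ε [ x ↦ v ]) y with em {x ≡ y}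
  ... | yes refl = v
  ... | no  _    = ε y

  -- The terms whose logical variables are among Γ.

  data Term (Γ : List L) : Ty → Set where
    const : ∀ {a} → Value a → Term Γ a
    pvar  : (x : X) → Term Γ (typeX x)
    lvar  : ∀ {l} → l ∈ Γ → Term Γ (typeL l)
    op₁   : ∀ {a b} → Op₁ a b → Term Γ a → Term Γ b
    op₂   : ∀ {a b c} → Op₂ a b c → Term Γ a → Term Γ b → Term Γ c

  LogicalValues : List L → Set
  LogicalValues = All (λ l → Value (typeL l))

  evalTerm : ∀ {Γ a} → Valuation → LogicalValues Γ → Term Γ a → Value a
  evalTerm ε ρ (const v)     = v
  evalTerm ε ρ (pvar x)      = ε x
  evalTerm ε ρ (lvar l∈Γ)    = lookupAll ρ l∈Γ
  evalTerm ε ρ (op₁ o t)     = ⟦ o ⟧₁ (evalTerm ε ρ t)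
  evalTerm ε ρ (op₂ o t₁ t₂) = ⟦ o ⟧₂ (evalTerm ε ρ t₁) (evalTerm ε ρ t₂)

  Exp : Ty → Set
  Exp = Term []

  eval : ∀ {a} → Valuation → Exp a → Value a
  eval ε = evalTerm ε []

  infixr 5 _⨾_
  infix  6 _≔_
  infixr 4 _⊓_ _⟨_⟩⊕_

  data Program : Set where
    _⊓_     : Program → Program → Program
    _⟨_⟩⊕_  : Program → Exp num → Program → Program
    _⨾_     : Program → Program → Program
    skip    : Program
    _≔_     : (x : X) → Exp (typeX x) → Program
    if_❴_❵else❴_❵ : Exp bool → Program → Program → Program
    while_❴_❵     : Exp bool → Program → Program

  State : Set
  State = Valuation × Program

  -- Only states ⟨ ε , s₁ ⊓ s₂ ⟩ offer a choice of action, so the values of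
  -- choose at other states are irrelevant.

  record Policy : Set where
    field
      choose    : State → Program
      available : ∀ ε s₁ s₂ →
                  choose (ε , s₁ ⊓ s₂) ≡ s₁ ⊎ choose (ε , s₁ ⊓ s₂) ≡ s₂

  open Policy public

  infix 3 _⊢_-[_]→_

  -- There is at most one p with π ⊢ σ -[ p ]→ σ′: the two branches of a
  -- probabilistic choice have the same target exactly when they are the same
  -- program, and then their probabilities are added.

  data _⊢_-[_]→_ (π : Policy) : State → ℝ → State → Set where

    assign : ∀ {ε x e} →
      π ⊢ (ε , x ≔ e) -[ 1# ]→ (ε [ x ↦ eval ε e ] , skip)

    ⊕-left : ∀ {ε s₁ s₂ e p} → eval ε e ≡ p → 0# ≤ p → p ≤ 1# → s₁ ≢ s₂ →
      π ⊢ (ε , s₁ ⟨ e ⟩⊕ s₂) -[ p ]→ (ε , s₁)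

    ⊕-right : ∀ {ε s₁ s₂ e p} → eval ε e ≡ p → 0# ≤ p → p ≤ 1# → s₁ ≢ s₂ →
      π ⊢ (ε , s₁ ⟨ e ⟩⊕ s₂) -[ 1# - p ]→ (ε , s₂)

    ⊕-same : ∀ {ε s₁ s₂ e p} → eval ε e ≡ p → 0# ≤ p → p ≤ 1# → s₁ ≡ s₂ →
      π ⊢ (ε , s₁ ⟨ e ⟩⊕ s₂) -[ p + (1# - p) ]→ (ε , s₁)

    demonic : ∀ {ε s₁ s₂ s} → choose π (ε , s₁ ⊓ s₂) ≡ s →
      π ⊢ (ε , s₁ ⊓ s₂) -[ 1# ]→ (ε , s)

    seq-skip : ∀ {ε ε′ s₁ s₂ p} →
      π ⊢ (ε , s₁) -[ p ]→ (ε′ , s₂) →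
      π ⊢ (ε , skip ⨾ s₁) -[ p ]→ (ε′ , s₂)

    seq : ∀ {ε ε′ s₁ s₂ s p} →
      π ⊢ (ε , s₁) -[ p ]→ (ε′ , s₂) →
      π ⊢ (ε , s₁ ⨾ s) -[ p ]→ (ε′ , s₂ ⨾ s)

    if-true : ∀ {ε e s₁ s₂} → eval ε e ≡ true →
      π ⊢ (ε , if e ❴ s₁ ❵else❴ s₂ ❵) -[ 1# ]→ (ε , s₁)

    if-false : ∀ {ε e s₁ s₂} → eval ε e ≡ false →
      π ⊢ (ε , if e ❴ s₁ ❵else❴ s₂ ❵) -[ 1# ]→ (ε , s₂)

    while-true : ∀ {ε e s} → eval ε e ≡ true →
      π ⊢ (ε , while e ❴ s ❵) -[ 1# ]→ (ε , s ⨾ while e ❴ s ❵)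

    while-false : ∀ {ε e s} → eval ε e ≡ false →
      π ⊢ (ε , while e ❴ s ❵) -[ 1# ]→ (ε , skip)

  Final : Policy → State → Set
  Final π σ = ¬ (∃[ p ] ∃[ σ′ ] π ⊢ σ -[ p ]→ σ′)

  data Path (π : Policy) : State → Set where
    stop : ∀ {σ} → Final π σ → Path π σ
    step : ∀ {σ σ′ p} → π ⊢ σ -[ p ]→ σ′ → 0# < p → Path π σ′ → Path π σ

  states : ∀ {π σ} → Path π σ → List State
  states {σ = σ} (stop _)     = σ ∷ []
  states {σ = σ} (step _ _ q) = σ ∷ states q

  Pr : ∀ {π σ} → Path π σ → ℝ
  Pr (stop _)             = 1#
  Pr (step {p = p} _ _ q) = p * Pr q

  final : ∀ {π σ} → Path π σ → State
  final {σ = σ} (stop _) = σ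
  final (step _ _ q)     = final q

  -- For a reward r ≥ 0 the sum over all paths is the supremum of the sums over
  -- finite sets of paths.  A path is a sequence of states, hence two elements
  -- of Path are distinct when their state sequences are.

  𝔼 : State → Policy → (State → ℝ) → ℝ
  𝔼 σ π r = ⨆ λ x → ∃[ qs ]
    Unique (map states qs) × x ≡ sum (map (λ (q : Path π σ) → Pr q * r (final q)) qs)

  𝐄 : State → (State → ℝ) → ℝ
  𝐄 σ r = ⨅ λ x → ∃[ π ] x ≡ 𝔼 σ π r

  indicator : Set → ℝ
  indicator P = if does (em {P}) then 1# else 0#

  Terminating : Program → Set
  Terminating s = ∀ ε π → 𝔼 (ε , s) π (λ σ → indicator (proj₂ σ ≡ skip)) ≡ 1#

  record LowerBound : Set where
    field
      bound   : Valuation → ℝ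
      bound≥0 : ∀ ε → 0# ≤ bound ε
      bound≤1 : ∀ ε → bound ε ≤ 1#

  open LowerBound public

  infix  9 ~_
  infix  9 [_]⟨_⟩_
  infixr 8 _∧_
  infixr 7 _∨_

  -- The formulae whose free logical variables are among Γ.

  data Formula (Γ : List L) : Set where
    atom    : Term Γ bool → Formula Γ
    ~_      : Formula Γ → Formula Γ
    _∧_     : Formula Γ → Formula Γ → Formula Γ
    all     : (l : L) → Formula (l ∷ Γ) → Formula Γ
    [_]⟨_⟩_ : Program → LowerBound → Formula Γ → Formula Γ

  _∨_ : ∀ {Γ} → Formula Γ → Formula Γ → Formula Γ
  φ ∨ ψ = ~ (~ φ ∧ ~ ψ)

  WellFormedFormula : Set
  WellFormedFormula = Formula []

  -- Sat ε ρ φ is satisfaction of φ[l := v]… , where ρ lists the substitutions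
  -- of values for logical variables made on the way to φ.

  mutual
    Sat : ∀ {Γ} → Valuation → LogicalValues Γ → Formula Γ → Set
    Sat ε ρ (atom t)        = evalTerm ε ρ t ≡ true
    Sat ε ρ (~ φ)           = ¬ Sat ε ρ φ
    Sat ε ρ (φ ∧ ψ)         = Sat ε ρ φ × Sat ε ρ ψ
    Sat ε ρ (all l φ)       = ∀ v → dom l v → Sat ε (v ∷ ρ) φ
    Sat ε ρ ([ s ]⟨ 𝐩 ⟩ φ)  = bound 𝐩 ε ≤ 𝐄 (ε , s) (λ σ → ⟦ φ ⟧ ρ (proj₁ σ))

    ⟦_⟧ : ∀ {Γ} → Formula Γ → LogicalValues Γ → Valuation → ℝ
    ⟦ φ ⟧ ρ ε = indicator (Sat ε ρ φ)

  infix 3 _⊨_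

  _⊨_ : Valuation → WellFormedFormula → Set
  ε ⊨ φ = Sat ε [] φ

  BoxesTerminating : ∀ {Γ} → Formula Γ → Set
  BoxesTerminating (atom _)        = ⊤
  BoxesTerminating (~ φ)           = BoxesTerminating φ
  BoxesTerminating (φ ∧ ψ)         = BoxesTerminating φ × BoxesTerminating ψ
  BoxesTerminating (all _ φ)       = BoxesTerminating φ
  BoxesTerminating ([ s ]⟨ _ ⟩ φ)  = Terminating s × BoxesTerminating φ

{-# OPTIONS --safe #-}

-- Under a fixed policy every non-final state branches into at most two
-- successors whose probabilities add up to at most 1, so by induction on the
-- length of paths the probabilities of finitely many distinct paths from a
-- state sum to at most 1.  Now let A and B be finite sets of paths witnessing
-- lower bounds for the probabilities of P and Q.  The paths of A that violate Q
-- and those of B that satisfy Q end in different states, hence are distinct and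
-- have total weight at most 1; the remaining paths of A in P satisfy P ∧ Q.
-- So 𝔼 P + 𝔼 Q ≤ 𝔼 (P ∧ Q) + 1 for every policy.  Disjunction is monotonicity.

module Submission where

open import Algebra.Bundles using (CommutativeRing)
import Algebra.Construct.NaturalChoice.MaxOp as MaxOp
import Algebra.Construct.NaturalChoice.MinOp as MinOp
import Algebra.Construct.NaturalChoice.Max as Max
import Algebra.Construct.NaturalChoice.Min as Min
import Algebra.Properties.Ring as RingProperties
open import Axiom.ExcludedMiddle using (ExcludedMiddle)
open import Data.Bool.Base using (true; false)
open import Data.Empty using (⊥-elim)
open import Data.List.Base using (List; []; _∷_; _++_; map; length; filter; last)
open import Data.List.Extrema.Nat using (xs≤max)
open import Data.List.Relation.Unary.All as All using (All; []; _∷_)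
import Data.List.Relation.Unary.All.Properties as All
open import Data.List.Relation.Unary.AllPairs as AllPairs using (AllPairs; []; _∷_)
import Data.List.Relation.Unary.AllPairs.Properties as AllPairs
open import Data.Maybe.Base using (just)
open import Data.Maybe.Properties using (just-injective)
open import Data.Nat.Base as ℕ using (ℕ; zero; suc; s≤s⁻¹)
open import Data.Product.Base using (_×_; _,_; ∃; ∃-syntax)
open import Data.Sum.Base as Sum using (_⊎_; inj₁; inj₂)
open import Function.Base using (_∘_)
open import Level using (0ℓ)
open import Relation.Binary.Bundles using (TotalOrder)
open import Relation.Binary.PropositionalEquality
  using (_≡_; _≢_; refl; sym; trans; cong; cong₂; subst; subst₂)
import Relation.Binary.Reasoning.PartialOrder as PartialOrderReasoning
open import Relation.Nullary using (¬_; yes; no; contradiction)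
open import Relation.Unary using (Decidable)
open import Defs

-- Arithmetic and infima in a complete ordered field.

module OrderedField (R : CompleteOrderedField) where

  open CompleteOrderedField R

  commutativeRing : CommutativeRing 0ℓ 0ℓ
  commutativeRing = record { isCommutativeRing = isCommutativeRing }

  open CommutativeRing commutativeRing public
    using ( +-assoc; +-comm; +-identityˡ; +-identityʳ; -‿inverseˡ; -‿inverseʳ
          ; *-identityˡ; *-identityʳ; distribˡ; zeroʳ)
  open RingProperties (CommutativeRing.ring commutativeRing) public
    using (-‿involutive; -‿distribˡ-*)
  open TotalOrder totalOrder public
    using (poset; total)
    renaming (refl to ≤-refl; trans to ≤-trans; reflexive to ≤-reflexive)
  open MaxOp (Max.maxOperator totalOrder) public using (⊔-lub)
  open MinOp (Min.minOperator totalOrder) public using (x⊓y≤x; x⊓y≤y)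
  open PartialOrderReasoning poset

  x-y+y≡x : ∀ x y → x - y + y ≡ x
  x-y+y≡x x y =
    trans (+-assoc x (- y) y) (trans (cong (x +_) (-‿inverseˡ y)) (+-identityʳ x))

  x+y-y≡x : ∀ x y → x + y - y ≡ x
  x+y-y≡x x y =
    trans (+-assoc x y (- y)) (trans (cong (x +_) (-‿inverseʳ y)) (+-identityʳ x))

  x+[y-x]≡y : ∀ x y → x + (y - x) ≡ y
  x+[y-x]≡y x y = trans (+-comm x (y - x)) (x-y+y≡x y x)

  +-monoˡ-≤ : ∀ z {x y} → x ≤ y → x + z ≤ y + z
  +-monoˡ-≤ z {x} {y} x≤y =
    subst₂ _≤_ (+-comm z x) (+-comm z y) (+-monoʳ-≤ z x≤y)

  +-mono-≤ : ∀ {x y u v} → x ≤ y → u ≤ v → x + u ≤ y + v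
  +-mono-≤ x≤y u≤v = ≤-trans (+-monoˡ-≤ _ x≤y) (+-monoʳ-≤ _ u≤v)

  x+y≤z⇒x≤z-y : ∀ {x} y {z} → x + y ≤ z → x ≤ z - y
  x+y≤z⇒x≤z-y {x} y x+y≤z =
    subst (_≤ _) (x+y-y≡x x y) (+-monoˡ-≤ (- y) x+y≤z)

  x≤z-y⇒x+y≤z : ∀ {x} y {z} → x ≤ z - y → x + y ≤ z
  x≤z-y⇒x+y≤z y {z} x≤z-y =
    subst (_ ≤_) (x-y+y≡x z y) (+-monoˡ-≤ y x≤z-y)

  x≤z+y⇒x-y≤z : ∀ {x} y {z} → x ≤ z + y → x - y ≤ z
  x≤z+y⇒x-y≤z y {z} x≤z+y =
    subst (_ ≤_) (x+y-y≡x z y) (+-monoˡ-≤ (- y) x≤z+y)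

  x≤y⇒0≤y-x : ∀ {x y} → x ≤ y → 0# ≤ y - x
  x≤y⇒0≤y-x {x} x≤y = x+y≤z⇒x≤z-y x (subst (_≤ _) (sym (+-identityˡ x)) x≤y)

  neg-mono-≤ : ∀ {x y} → x ≤ y → - y ≤ - x
  neg-mono-≤ {x} {y} x≤y = begin
    - y           ≡⟨ +-identityʳ (- y) ⟨
    - y + 0#      ≤⟨ +-monoʳ-≤ (- y) (x≤y⇒0≤y-x x≤y) ⟩
    - y + (y - x) ≡⟨ +-assoc (- y) y (- x) ⟨
    - y + y - x   ≡⟨ cong (_- x) (-‿inverseˡ y) ⟩
    0# - x        ≡⟨ +-identityˡ (- x) ⟩
    - x           ∎

  *-monoʳ-≤ : ∀ {x y z} → 0# ≤ x → y ≤ z → x * y ≤ x * z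
  *-monoʳ-≤ {x} {y} {z} 0≤x y≤z = begin
    x * y               ≡⟨ +-identityˡ (x * y) ⟨
    0# + x * y          ≤⟨ +-monoˡ-≤ (x * y) (*-nonNegative 0≤x (x≤y⇒0≤y-x y≤z)) ⟩
    x * (z - y) + x * y ≡⟨ distribˡ x (z - y) y ⟨
    x * (z - y + y)     ≡⟨ cong (x *_) (x-y+y≡x z y) ⟩
    x * z               ∎

  -- The order axioms do not mention `1#`. If `1# ≤ 0#`, then `- 1#` is nonnegative, and so is its
  -- square, which is `1#`.
  0≤1 : 0# ≤ 1#
  0≤1 with total 0# 1#
  ... | inj₁ 0≤1 = 0≤1
  ... | inj₂ 1≤0 = subst (0# ≤_) [-1]²≡1 (*-nonNegative 0≤-1 0≤-1)
    where
    0≤-1 : 0# ≤ - 1#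
    0≤-1 = subst (0# ≤_) (+-identityˡ (- 1#)) (x≤y⇒0≤y-x 1≤0)

    [-1]²≡1 : - 1# * - 1# ≡ 1#
    [-1]²≡1 =
      trans (sym (-‿distribˡ-* 1# (- 1#)))
            (trans (cong -_ (*-identityˡ (- 1#))) (-‿involutive 1#))

  convex≤1 : ∀ {p a b} → 0# ≤ p → p ≤ 1# → a ≤ 1# → b ≤ 1# →
             p * a + (1# - p) * b ≤ 1#
  convex≤1 {p} {a} {b} 0≤p p≤1 a≤1 b≤1 = begin
    p * a + (1# - p) * b   ≤⟨ +-mono-≤ (*-monoʳ-≤ 0≤p a≤1) (*-monoʳ-≤ (x≤y⇒0≤y-x p≤1) b≤1) ⟩
    p * 1# + (1# - p) * 1# ≡⟨ cong₂ _+_ (*-identityʳ p) (*-identityʳ (1# - p)) ⟩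
    p + (1# - p)           ≡⟨ x+[y-x]≡y p 1# ⟩
    1#                     ∎

  -- `⨆` is specified only on sets bounded above, so some lower bound `b` of `S` must be supplied:
  -- `- b` then bounds the reflected set whose supremum defines `⨅ S`.
  ⨅-lower : ∀ (S : ℝ → Set) {b} → (∀ x → S x → b ≤ x) → ∀ x → S x → ⨅ S ≤ x
  ⨅-lower S {b} b≤S x x∈S =
    subst (⨅ S ≤_) (-‿involutive x)
      (neg-mono-≤ (⨆-upper (S ∘ -_) (- b , -S≤-b) (- x)
        (subst S (sym (-‿involutive x)) x∈S)))
    where
    -S≤-b : UpperBound (S ∘ -_) (- b)
    -S≤-b y -y∈S = subst (_≤ - b) (-‿involutive y) (neg-mono-≤ (b≤S (- y) -y∈S))

  ⨅-greatest : ∀ (S : ℝ → Set) {b} → ∃ S → (∀ x → S x → b ≤ x) → b ≤ ⨅ S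
  ⨅-greatest S {b} (x , x∈S) b≤S =
    subst (_≤ ⨅ S) (-‿involutive b)
      (neg-mono-≤ (⨆-least (S ∘ -_) (- x , subst S (sym (-‿involutive x)) x∈S) (- b)
        λ y -y∈S → subst (_≤ - b) (-‿involutive y) (neg-mono-≤ (b≤S (- y) -y∈S))))

  -- Finite sums.

  interchange : ∀ a b c d → (a + b) + (c + d) ≡ (a + c) + (b + d)
  interchange a b c d = begin-equality
    (a + b) + (c + d) ≡⟨ +-assoc a b (c + d) ⟩
    a + (b + (c + d)) ≡⟨ cong (a +_) (+-assoc b c d) ⟨
    a + ((b + c) + d) ≡⟨ cong (λ t → a + (t + d)) (+-comm b c) ⟩
    a + ((c + b) + d) ≡⟨ cong (a +_) (+-assoc c b d) ⟩
    a + (c + (b + d)) ≡⟨ +-assoc a c (b + d) ⟨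
    (a + c) + (b + d) ∎

  module _ {A : Set} where

    ∑ : (A → ℝ) → List A → ℝ
    ∑ f xs = sum (map f xs)

    ∑-mono : ∀ {f g : A → ℝ} → (∀ x → f x ≤ g x) → ∀ xs → ∑ f xs ≤ ∑ g xs
    ∑-mono f≤g []       = ≤-refl
    ∑-mono f≤g (x ∷ xs) = +-mono-≤ (f≤g x) (∑-mono f≤g xs)

    ∑-+ : ∀ (f g : A → ℝ) xs → ∑ (λ x → f x + g x) xs ≡ ∑ f xs + ∑ g xs
    ∑-+ f g []       = sym (+-identityˡ 0#)
    ∑-+ f g (x ∷ xs) =
      trans (cong (f x + g x +_) (∑-+ f g xs)) (interchange (f x) (g x) (∑ f xs) (∑ g xs))

    ∑-++ : ∀ (f : A → ℝ) xs ys → ∑ f (xs ++ ys) ≡ ∑ f xs + ∑ f ys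
    ∑-++ f []       ys = sym (+-identityˡ (∑ f ys))
    ∑-++ f (x ∷ xs) ys =
      trans (cong (f x +_) (∑-++ f xs ys)) (sym (+-assoc (f x) (∑ f xs) (∑ f ys)))

module Expectations (em : ExcludedMiddle 0ℓ) (R : CompleteOrderedField)
                    (S : Signature (CompleteOrderedField.ℝ R)) where

  open CompleteOrderedField R
  open OrderedField R
  open pDL em R S
  open PartialOrderReasoning poset

  -- Indicators of propositions.

  em? : ∀ {A : Set} (P : A → Set) → Decidable P
  em? P x = em {P x}

  0≤indicator : ∀ P → 0# ≤ indicator P
  0≤indicator P with em {P}
  ... | yes _ = 0≤1
  ... | no  _ = ≤-refl

  indicator≤1 : ∀ P → indicator P ≤ 1#
  indicator≤1 P with em {P}
  ... | yes _ = ≤-refl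
  ... | no  _ = 0≤1

  indicator-mono : ∀ {P Q : Set} → (P → Q) → indicator P ≤ indicator Q
  indicator-mono {P} {Q} P⇒Q with em {P} | em {Q}
  ... | yes p | yes q = ≤-refl
  ... | yes p | no ¬q = contradiction (P⇒Q p) ¬q
  ... | no  _ | yes q = 0≤1
  ... | no  _ | no ¬q = ≤-refl

  indicator-split : ∀ P Q → indicator P ≤ indicator (P × Q) + indicator (¬ Q)
  indicator-split P Q with em {Q}
  ... | yes q = begin
    indicator P                           ≤⟨ indicator-mono (_, q) ⟩
    indicator (P × Q)                     ≡⟨ +-identityʳ _ ⟨
    indicator (P × Q) + 0#                ≤⟨ +-monoʳ-≤ _ (0≤indicator (¬ Q)) ⟩
    indicator (P × Q) + indicator (¬ Q)   ∎
  ... | no ¬q = begin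
    indicator P                           ≤⟨ indicator-mono (λ _ → ¬q) ⟩
    indicator (¬ Q)                       ≡⟨ +-identityˡ _ ⟨
    0# + indicator (¬ Q)                  ≤⟨ +-monoˡ-≤ _ (0≤indicator (P × Q)) ⟩
    indicator (P × Q) + indicator (¬ Q)   ∎

  -- Trades an indicator for a sublist, so that weighted sums over two lists of paths can be merged
  -- into one unweighted sum over a concatenation.
  ∑-indicator : ∀ {A : Set} (f : A → ℝ) (P : A → Set) xs →
                ∑ (λ x → f x * indicator (P x)) xs ≡ ∑ f (filter (em? P) xs)
  ∑-indicator f P [] = refl
  ∑-indicator f P (x ∷ xs) with em {P x}
  ... | yes _ = cong₂ _+_ (*-identityʳ (f x)) (∑-indicator f P xs)
  ... | no  _ = trans (cong₂ _+_ (zeroʳ (f x)) (∑-indicator f P xs)) (+-identityˡ _)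

  -- All transitions of σ lead to one of two states, with probabilities p and
  -- 1 - p.  The two states may coincide and either may be unreachable.

  record Branching (π : Policy) (σ : State) : Set where
    constructor branching
    field
      {p}     : ℝ
      {σ₁ σ₂} : State
      0≤p     : 0# ≤ p
      p≤1     : p ≤ 1#
      branch  : ∀ {q σ′} → π ⊢ σ -[ q ]→ σ′ →
                (q ≡ p × σ′ ≡ σ₁) ⊎ (q ≡ 1# - p × σ′ ≡ σ₂)

  -- Transitions under a fixed policy.

  module _ {π : Policy} where

    -- The second branch has probability `1# - 1#` and a dummy target.
    deterministic : ∀ {σ} σ₁ →
      (∀ {q σ′} → π ⊢ σ -[ q ]→ σ′ → q ≡ 1# × σ′ ≡ σ₁) → Branching π σ
    deterministic σ₁ f = branching {σ₂ = σ₁} 0≤1 ≤-refl (inj₁ ∘ f)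

    branches : ∀ ε s → Branching π (ε , s)
    branches ε (s₁ ⊓ s₂) =
      deterministic (ε , choose π (ε , s₁ ⊓ s₂)) λ { (demonic refl) → refl , refl }
    branches ε (s₁ ⟨ e ⟩⊕ s₂) with em {0# ≤ eval ε e × eval ε e ≤ 1#} | em {s₁ ≡ s₂}
    -- Outside the unit interval the choice has no transition at all, so any target will do.
    ... | no ¬[0,1] | _ = deterministic (ε , s₁) λ
      { (⊕-left  refl 0≤p p≤1 _) → contradiction (0≤p , p≤1) ¬[0,1]
      ; (⊕-right refl 0≤p p≤1 _) → contradiction (0≤p , p≤1) ¬[0,1]
      ; (⊕-same  refl 0≤p p≤1 _) → contradiction (0≤p , p≤1) ¬[0,1] }
    ... | yes _ | yes s₁≡s₂ = deterministic (ε , s₁) λ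
      { (⊕-left  _ _ _ s₁≢s₂) → contradiction s₁≡s₂ s₁≢s₂
      ; (⊕-right _ _ _ s₁≢s₂) → contradiction s₁≡s₂ s₁≢s₂
      ; (⊕-same  _ _ _ _)     → x+[y-x]≡y _ 1# , refl }
    ... | yes (0≤p , p≤1) | no s₁≢s₂ = branching {σ₁ = ε , s₁} {ε , s₂} 0≤p p≤1 λ
      { (⊕-left  refl _ _ _)  → inj₁ (refl , refl)
      ; (⊕-right refl _ _ _)  → inj₂ (refl , refl)
      ; (⊕-same  _ _ _ s₁≡s₂) → contradiction s₁≡s₂ s₁≢s₂ }
    branches ε (s₁ ⨾ s₂) with em {s₁ ≡ skip}
    -- `seq` would need a transition out of `skip`, so only the transitions inherited from `s₂`
    -- remain.
    ... | yes refl = branching 0≤p p≤1 λ { (seq-skip t) → branch t ; (seq ()) }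
      where
      open Branching (branches ε s₂)
    ... | no s₁≢skip = branching 0≤p p≤1 λ
      { (seq-skip _) → contradiction refl s₁≢skip
      ; (seq t)      → Sum.map (λ { (q , refl) → q , refl })
                               (λ { (q , refl) → q , refl }) (branch t) }
      where
      open Branching (branches ε s₁)
    branches ε skip    = deterministic (ε , skip) λ ()
    branches ε (x ≔ e) =
      deterministic (ε [ x ↦ eval ε e ] , skip) λ { assign → refl , refl }
    branches ε if e ❴ s₁ ❵else❴ s₂ ❵ with eval ε e in eq
    ... | true  = deterministic (ε , s₁) λ
      { (if-true _)   → refl , refl
      ; (if-false ¬e) → contradiction (trans (sym eq) ¬e) λ () }
    ... | false = deterministic (ε , s₂) λ
      { (if-true e)  → contradiction (trans (sym eq) e) λ ()
      ; (if-false _) → refl , refl }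
    branches ε while e ❴ s ❵ with eval ε e in eq
    ... | true  = deterministic (ε , s ⨾ while e ❴ s ❵) λ
      { (while-true _)   → refl , refl
      ; (while-false ¬e) → contradiction (trans (sym eq) ¬e) λ () }
    ... | false = deterministic (ε , skip) λ
      { (while-true e)  → contradiction (trans (sym eq) e) λ ()
      ; (while-false _) → refl , refl }

    -- Paths and the total probability of distinct paths.

    0≤Pr : ∀ {σ} (q : Path π σ) → 0# ≤ Pr q
    0≤Pr (stop _)             = 0≤1
    0≤Pr (step _ (0≤p , _) q) = *-nonNegative 0≤p (0≤Pr q)

    -- Makes the final state a function of the state sequence, so that paths with different final
    -- states are distinct.
    last-states : ∀ {σ} (q : Path π σ) → last (states q) ≡ just (final q)
    last-states (stop _)                  = refl
    last-states (step _ _ (stop _))       = refl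
    last-states (step _ _ q@(step _ _ _)) = last-states q

    Distinct : ∀ {σ} → List (Path π σ) → Set
    Distinct = AllPairs (λ q q′ → states q ≢ states q′)

    length-states : ∀ {σ} → Path π σ → ℕ
    length-states = length ∘ states

    -- The paths of `qs` are sorted by their first transition, which is then removed. The fields
    -- `all₁` and `all₂` allow an arbitrary predicate `K` on state sequences because they serve
    -- twice: for inequality with a given sequence and for a bound on length.
    record Tails {σ} (qs : List (Path π σ)) (p : ℝ) (σ₁ σ₂ : State) : Set₁ where
      field
        qs₁ : List (Path π σ₁)
        qs₂ : List (Path π σ₂)
        ∑Pr : ∑ Pr qs ≡ p * ∑ Pr qs₁ + (1# - p) * ∑ Pr qs₂
        all₁ : ∀ (K : List State → Set) → All (K ∘ states) qs →
               All (λ q → K (σ ∷ states q)) qs₁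
        all₂ : ∀ (K : List State → Set) → All (K ∘ states) qs →
               All (λ q → K (σ ∷ states q)) qs₂
        distinct₁ : Distinct qs → Distinct qs₁
        distinct₂ : Distinct qs → Distinct qs₂

    tails : ∀ {σ} → ¬ Final π σ → (b : Branching π σ) → let open Branching b in
            (qs : List (Path π σ)) → Tails qs p σ₁ σ₂
    tails ¬fin b [] = record
      { qs₁ = [] ; qs₂ = []
      ; ∑Pr = sym (trans (cong₂ _+_ (zeroʳ _) (zeroʳ _)) (+-identityˡ 0#))
      ; all₁ = λ _ _ → [] ; all₂ = λ _ _ → []
      ; distinct₁ = λ _ → [] ; distinct₂ = λ _ → [] }
    tails ¬fin b (stop fin ∷ qs) = contradiction fin ¬fin
    tails {σ} ¬fin b (step t _ q ∷ qs) with Branching.branch b t | tails ¬fin b qs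
    ... | inj₁ (refl , refl) | ts = record
      { qs₁ = q ∷ qs₁ ; qs₂ = qs₂
      ; ∑Pr = begin-equality
          p * Pr q + ∑ Pr qs                          ≡⟨ cong (p * Pr q +_) ∑Pr ⟩
          p * Pr q + (p * ∑ Pr qs₁ + p′ * ∑ Pr qs₂)   ≡⟨ +-assoc _ _ _ ⟨
          p * Pr q + p * ∑ Pr qs₁ + p′ * ∑ Pr qs₂     ≡⟨ cong (_+ p′ * ∑ Pr qs₂) (distribˡ p _ _) ⟨
          p * (Pr q + ∑ Pr qs₁) + p′ * ∑ Pr qs₂       ∎
      ; all₁ = λ { K (k ∷ ks) → k ∷ all₁ K ks } ; all₂ = λ { K (_ ∷ ks) → all₂ K ks }
      -- All paths in `qs` begin with `σ`, so equal tails would give equal state sequences.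
      ; distinct₁ = λ { (q∉ ∷ d) →
          All.map (λ ≢ → ≢ ∘ cong (σ ∷_)) (all₁ ((σ ∷ states q) ≢_) q∉) ∷ distinct₁ d }
      ; distinct₂ = λ { (_ ∷ d) → distinct₂ d } }
      where
      open Branching b
      open Tails ts
      p′ = 1# - p
    ... | inj₂ (refl , refl) | ts = record
      { qs₁ = qs₁ ; qs₂ = q ∷ qs₂
      ; ∑Pr = begin-equality
          p′ * Pr q + ∑ Pr qs                             ≡⟨ cong (p′ * Pr q +_) ∑Pr ⟩
          p′ * Pr q + (p * ∑ Pr qs₁ + p′ * ∑ Pr qs₂)      ≡⟨ cong (p′ * Pr q +_) (+-comm _ _) ⟩
          p′ * Pr q + (p′ * ∑ Pr qs₂ + p * ∑ Pr qs₁)      ≡⟨ +-assoc _ _ _ ⟨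
          p′ * Pr q + p′ * ∑ Pr qs₂ + p * ∑ Pr qs₁        ≡⟨ +-comm _ _ ⟩
          p * ∑ Pr qs₁ + (p′ * Pr q + p′ * ∑ Pr qs₂)      ≡⟨ cong (p * ∑ Pr qs₁ +_) (distribˡ p′ _ _) ⟨
          p * ∑ Pr qs₁ + p′ * (Pr q + ∑ Pr qs₂)           ∎
      ; all₁ = λ { K (_ ∷ ks) → all₁ K ks } ; all₂ = λ { K (k ∷ ks) → k ∷ all₂ K ks }
      ; distinct₁ = λ { (_ ∷ d) → distinct₁ d }
      ; distinct₂ = λ { (q∉ ∷ d) →
          All.map (λ ≢ → ≢ ∘ cong (σ ∷_)) (all₂ ((σ ∷ states q) ≢_) q∉) ∷ distinct₂ d } }
      where
      open Branching b
      open Tails ts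
      p′ = 1# - p

    -- A final state has only the one-state path, so a distinct list has at most one entry.
    final-∑Pr≤1 : ∀ {σ} → Final π σ → (qs : List (Path π σ)) → Distinct qs → ∑ Pr qs ≤ 1#
    final-∑Pr≤1 fin []                         _ = 0≤1
    final-∑Pr≤1 fin (step t _ _ ∷ _)           _ = ⊥-elim (fin (_ , _ , t))
    final-∑Pr≤1 fin (stop _ ∷ [])              _ = ≤-reflexive (+-identityʳ 1#)
    final-∑Pr≤1 fin (stop _ ∷ stop _ ∷ _)      ((≢ ∷ _) ∷ _) = contradiction refl ≢
    final-∑Pr≤1 fin (stop _ ∷ step t _ _ ∷ _)  _ = ⊥-elim (fin (_ , _ , t))

    -- Induction on the length bound: at a non-final state the sum is a convex combination of the
    -- sums over the two lists of tails, each of which is one state shorter per path.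
    bounded-∑Pr≤1 : ∀ n {σ} (qs : List (Path π σ)) →
                    All (λ q → length-states q ℕ.≤ n) qs → Distinct qs → ∑ Pr qs ≤ 1#
    bounded-∑Pr≤1 n       []       _  _ = 0≤1
    -- Lengths count states, not transitions, so even a stopped path has length 1.
    bounded-∑Pr≤1 zero    (stop _ ∷ _)     (() ∷ _)
    bounded-∑Pr≤1 zero    (step _ _ _ ∷ _) (() ∷ _)
    bounded-∑Pr≤1 (suc n) {σ@(ε , s)} qs@(_ ∷ _) ≤n d with em {Final π σ}
    ... | yes fin = final-∑Pr≤1 fin qs d
    ... | no ¬fin = begin
      ∑ Pr qs                             ≡⟨ ∑Pr ⟩
      p * ∑ Pr qs₁ + (1# - p) * ∑ Pr qs₂  ≤⟨ convex≤1 0≤p p≤1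
        (bounded-∑Pr≤1 n qs₁ (All.map s≤s⁻¹ (all₁ (λ xs → length xs ℕ.≤ suc n) ≤n)) (distinct₁ d))
        (bounded-∑Pr≤1 n qs₂ (All.map s≤s⁻¹ (all₂ (λ xs → length xs ℕ.≤ suc n) ≤n)) (distinct₂ d)) ⟩
      1#                                  ∎
      where
      open Branching (branches ε s)

      tails-of-qs : Tails qs p σ₁ σ₂
      tails-of-qs = tails ¬fin (branches ε s) qs

      open Tails tails-of-qs

    ∑Pr≤1 : ∀ {σ} (qs : List (Path π σ)) → Distinct qs → ∑ Pr qs ≤ 1#
    -- The bound is the maximal length in the finite list, with 0 as the default for the empty one.
    ∑Pr≤1 qs = bounded-∑Pr≤1 _ qs (All.map⁻ (xs≤max 0 (map length-states qs)))

    -- Probabilities of events on final states.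

    probability : ∀ {σ} → (State → Set) → Path π σ → ℝ
    probability P q = Pr q * indicator (P (final q))

    probability≤Pr : ∀ {σ} (P : State → Set) (q : Path π σ) → probability P q ≤ Pr q
    probability≤Pr P q =
      subst (probability P q ≤_) (*-identityʳ (Pr q)) (*-monoʳ-≤ (0≤Pr q) (indicator≤1 _))

    satisfying : ∀ {σ} → (State → Set) → List (Path π σ) → List (Path π σ)
    satisfying P = filter (em? (P ∘ final))

    -- A path common to both sublists would have a final state at which `P` both holds and fails.
    separated : ∀ {σ} (P : State → Set) (qs qs′ : List (Path π σ)) →
                Distinct qs → Distinct qs′ →
                Distinct (satisfying (¬_ ∘ P) qs ++ satisfying P qs′)
    separated P qs qs′ d d′ = AllPairs.++⁺
      (AllPairs.filter⁺ (em? (¬_ ∘ P ∘ final)) d) (AllPairs.filter⁺ (em? (P ∘ final)) d′)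
      (All.map
        (λ {q} ¬P → All.map
          (λ {q′} Pq′ eq → ¬P (subst P (sym (final-unique q q′ eq)) Pq′))
          (All.all-filter (em? (P ∘ final)) qs′))
        (All.all-filter (em? (¬_ ∘ P ∘ final)) qs))
      where
      final-unique : ∀ {σ} (q q′ : Path π σ) → states q ≡ states q′ → final q ≡ final q′
      final-unique q q′ eq = just-injective
        (trans (sym (last-states q)) (trans (cong last eq) (last-states q′)))

    module _ {σ : State} where

      -- The set whose supremum defines `𝔼` for the reward `indicator ∘ P`, with `Unique` unfolded.
      Sums : (State → Set) → ℝ → Set
      Sums P x = ∃[ qs ] AllPairs _≢_ (map states qs) × x ≡ ∑ (probability {σ} P) qs

      ℙ : (State → Set) → ℝ
      ℙ P = 𝔼 σ π (λ τ → indicator (P τ))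

      ∑≤ℙ : ∀ P qs → Distinct qs → ∑ (probability {σ} P) qs ≤ ℙ P
      ∑≤ℙ P qs d = ⨆-upper (Sums P) (1# , ≤1) _ (qs , AllPairs.map⁺ d , refl)
        where
        -- The supremum dominates its set only once the set is known to be bounded; total mass at
        -- most 1 provides this.
        ≤1 : UpperBound (Sums P) 1#
        ≤1 _ (qs , u , refl) = ≤-trans (∑-mono (probability≤Pr P) qs) (∑Pr≤1 qs (AllPairs.map⁻ u))

      ℙ≤ : ∀ P {b} → (∀ qs → Distinct qs → ∑ (probability {σ} P) qs ≤ b) → ℙ P ≤ b
      ℙ≤ P ∑≤b = ⨆-least (Sums P) (0# , [] , [] , refl) _
        λ { _ (qs , u , refl) → ∑≤b qs (AllPairs.map⁻ u) }

      0≤ℙ : ∀ P → 0# ≤ ℙ P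
      0≤ℙ P = ∑≤ℙ P [] []

      ℙ-mono : ∀ {P Q : State → Set} → (∀ τ → P τ → Q τ) → ℙ P ≤ ℙ Q
      ℙ-mono {P} {Q} P⇒Q = ℙ≤ P λ qs d → ≤-trans
        (∑-mono (λ q → *-monoʳ-≤ (0≤Pr q) (indicator-mono (P⇒Q (final q)))) qs)
        (∑≤ℙ Q qs d)

      module _ (P Q : State → Set) where

        P∧Q : State → Set
        P∧Q τ = P τ × Q τ

        ∑-∧ : ∀ qs → ∑ (probability {σ} P) qs
                     ≤ ∑ (probability P∧Q) qs + ∑ Pr (satisfying (¬_ ∘ Q) qs)
        ∑-∧ qs = begin
          ∑ (probability P) qs
            ≤⟨ ∑-mono (λ q → *-monoʳ-≤ (0≤Pr q) (indicator-split (P (final q)) (Q (final q)))) qs ⟩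
          ∑ (λ q → Pr q * (indicator (P∧Q (final q)) + indicator (¬ Q (final q)))) qs
            ≤⟨ ∑-mono (λ q → ≤-reflexive (distribˡ (Pr q) _ _)) qs ⟩
          ∑ (λ q → probability P∧Q q + probability (¬_ ∘ Q) q) qs
            ≡⟨ ∑-+ (probability P∧Q) (probability (¬_ ∘ Q)) qs ⟩
          ∑ (probability P∧Q) qs + ∑ (probability (¬_ ∘ Q)) qs
            ≡⟨ cong (∑ (probability P∧Q) qs +_) (∑-indicator Pr (¬_ ∘ Q ∘ final) qs) ⟩
          ∑ (probability P∧Q) qs + ∑ Pr (satisfying (¬_ ∘ Q) qs) ∎

        -- The two lists are independent of each other, so that each supremum can be taken
        -- separately afterwards. The merged list of paths violating `Q` and paths satisfying `Q`
        -- accounts for the summand `1#`.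
        ∑-∧-bound : ∀ qs qs′ → Distinct qs → Distinct qs′ →
                    ∑ (probability Q) qs′ + ∑ (probability P) qs ≤ ℙ P∧Q + 1#
        ∑-∧-bound qs qs′ d d′ = begin
          ∑ (probability Q) qs′ + ∑ (probability P) qs
            ≡⟨ +-comm _ _ ⟩
          ∑ (probability P) qs + ∑ (probability Q) qs′
            ≤⟨ +-monoˡ-≤ _ (∑-∧ qs) ⟩
          ∑ (probability P∧Q) qs + ∑ Pr (satisfying (¬_ ∘ Q) qs) + ∑ (probability Q) qs′
            ≡⟨ +-assoc _ _ _ ⟩
          ∑ (probability P∧Q) qs + (∑ Pr (satisfying (¬_ ∘ Q) qs) + ∑ (probability Q) qs′)
            ≡⟨ cong (λ x → _ + (_ + x)) (∑-indicator Pr (Q ∘ final) qs′) ⟩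
          ∑ (probability P∧Q) qs + (∑ Pr (satisfying (¬_ ∘ Q) qs) + ∑ Pr (satisfying Q qs′))
            ≡⟨ cong (_ +_) (∑-++ Pr (satisfying (¬_ ∘ Q) qs) (satisfying Q qs′)) ⟨
          ∑ (probability P∧Q) qs + ∑ Pr (satisfying (¬_ ∘ Q) qs ++ satisfying Q qs′)
            ≤⟨ +-mono-≤ (∑≤ℙ P∧Q qs d) (∑Pr≤1 _ (separated Q qs qs′ d d′)) ⟩
          ℙ P∧Q + 1# ∎

        ℙ-∧ : ℙ P + ℙ Q ≤ ℙ P∧Q + 1#
        -- Each supremum is isolated by moving the other summand across the inequality: first the
        -- one over `qs`, then, with `qs` fixed, the one over `qs′`.
        ℙ-∧ = x≤z-y⇒x+y≤z (ℙ Q) (ℙ≤ P λ qs d →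
          x+y≤z⇒x≤z-y (ℙ Q) (subst (_≤ ℙ P∧Q + 1#) (+-comm (ℙ Q) _)
            (x≤z-y⇒x+y≤z _ (ℙ≤ Q λ qs′ d′ →
              x+y≤z⇒x≤z-y _ (∑-∧-bound qs qs′ d d′)))))

  -- The infimum over policies.

  leftmost : Policy
  leftmost = record { choose = left ; available = λ _ _ _ → inj₁ refl }
    where
    left : State → Program
    left (_ , s₁ ⊓ _) = s₁
    left (_ , s)      = s

  𝐄≤ℙ : ∀ {σ} π (P : State → Set) →
        𝐄 σ (λ τ → indicator (P τ)) ≤ 𝔼 σ π (λ τ → indicator (P τ))
  𝐄≤ℙ {σ} π P = ⨅-lower (λ x → ∃[ π ] x ≡ 𝔼 σ π (λ τ → indicator (P τ)))
    -- The lower bound that makes the infimum meaningful is 0.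
    (λ { _ (π , refl) → 0≤ℙ P }) _ (π , refl)

  ≤𝐄 : ∀ {σ b} (P : State → Set) →
       (∀ π → b ≤ 𝔼 σ π (λ τ → indicator (P τ))) → b ≤ 𝐄 σ (λ τ → indicator (P τ))
  ≤𝐄 {σ} P b≤ℙ = ⨅-greatest (λ x → ∃[ π ] x ≡ 𝔼 σ π (λ τ → indicator (P τ)))
    -- `leftmost` shows that the set of expectations is inhabited, as the greatest-lower-bound
    -- property requires.
    (_ , leftmost , refl) (λ { _ (π , refl) → b≤ℙ π })

  -- The conjunction and disjunction rules for boxes.

  Holds : WellFormedFormula → State → Set
  Holds φ (ε , _) = ε ⊨ φ

  module _ (ε : Valuation) (𝐩 𝐩₁ 𝐩₂ : LowerBound) (s : Program)
           (φ₁ φ₂ : WellFormedFormula) where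

    box-∧ : bound 𝐩 ε ≡ max (bound 𝐩₁ ε + bound 𝐩₂ ε - 1#) 0# →
            ε ⊨ [ s ]⟨ 𝐩₁ ⟩ φ₁ → ε ⊨ [ s ]⟨ 𝐩₂ ⟩ φ₂ → ε ⊨ [ s ]⟨ 𝐩 ⟩ (φ₁ ∧ φ₂)
    box-∧ 𝐩≡ ⊨₁ ⊨₂ = subst (_≤ _) (sym 𝐩≡) (≤𝐄 (Holds (φ₁ ∧ φ₂)) λ π →
      -- Both arguments of the maximum lie below the probability of the conjunction: the first by
      -- `ℙ-∧`, the second by nonnegativity.
      ⊔-lub
        (x≤z+y⇒x-y≤z 1# (≤-trans
          (+-mono-≤ (≤-trans ⊨₁ (𝐄≤ℙ π (Holds φ₁))) (≤-trans ⊨₂ (𝐄≤ℙ π (Holds φ₂))))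
          (ℙ-∧ (Holds φ₁) (Holds φ₂))))
        (0≤ℙ (Holds (φ₁ ∧ φ₂))))

    box-∨ : bound 𝐩 ε ≡ min (bound 𝐩₁ ε) (bound 𝐩₂ ε) →
            (ε ⊨ [ s ]⟨ 𝐩₁ ⟩ φ₁) ⊎ (ε ⊨ [ s ]⟨ 𝐩₂ ⟩ φ₂) → ε ⊨ [ s ]⟨ 𝐩 ⟩ (φ₁ ∨ φ₂)
    box-∨ 𝐩≡ (inj₁ ⊨₁) = subst (_≤ _) (sym 𝐩≡) (≤𝐄 (Holds (φ₁ ∨ φ₂)) λ π →
      ≤-trans (x⊓y≤x _ _) (≤-trans ⊨₁ (≤-trans (𝐄≤ℙ π (Holds φ₁))
        -- Disjunction is the negation of a conjunction of negations, so a proof of one disjunct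
        -- refutes the matching component.
        (ℙ-mono {P = Holds φ₁} {Holds (φ₁ ∨ φ₂)} λ _ h (¬φ₁ , _) → ¬φ₁ h))))
    box-∨ 𝐩≡ (inj₂ ⊨₂) = subst (_≤ _) (sym 𝐩≡) (≤𝐄 (Holds (φ₁ ∨ φ₂)) λ π →
      ≤-trans (x⊓y≤y _ _) (≤-trans ⊨₂ (≤-trans (𝐄≤ℙ π (Holds φ₂))
        (ℙ-mono {P = Holds φ₂} {Holds (φ₁ ∨ φ₂)} λ _ h (_ , ¬φ₂) → ¬φ₂ h))))

theorem5 :
    (em : ExcludedMiddle 0ℓ) (R : CompleteOrderedField) →
    (S : Signature (CompleteOrderedField.ℝ R)) →
    let open CompleteOrderedField R
        open pDL em R S
    in
    (ε : Valuation) (𝐩 𝐩₁ 𝐩₂ : LowerBound) (s : Program) →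
    (φ₁ φ₂ : WellFormedFormula) →
    Terminating s → BoxesTerminating φ₁ → BoxesTerminating φ₂ →
    ( (∀ ε′ → bound 𝐩 ε′ ≡ max (bound 𝐩₁ ε′ + bound 𝐩₂ ε′ - 1#) 0#) →
      ε ⊨ [ s ]⟨ 𝐩₁ ⟩ φ₁ → ε ⊨ [ s ]⟨ 𝐩₂ ⟩ φ₂ →
      ε ⊨ [ s ]⟨ 𝐩 ⟩ (φ₁ ∧ φ₂) )
    ×
    ( (∀ ε′ → bound 𝐩 ε′ ≡ min (bound 𝐩₁ ε′) (bound 𝐩₂ ε′)) →
      (ε ⊨ [ s ]⟨ 𝐩₁ ⟩ φ₁) ⊎ (ε ⊨ [ s ]⟨ 𝐩₂ ⟩ φ₂) →
      ε ⊨ [ s ]⟨ 𝐩 ⟩ (φ₁ ∨ φ₂) )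
theorem5 em R S ε 𝐩 𝐩₁ 𝐩₂ s φ₁ φ₂ _ _ _ =
  (λ 𝐩≡ → box-∧ ε 𝐩 𝐩₁ 𝐩₂ s φ₁ φ₂ (𝐩≡ ε)) ,
  (λ 𝐩≡ → box-∨ ε 𝐩 𝐩₁ 𝐩₂ s φ₁ φ₂ (𝐩≡ ε))
  where
  open Expectations em R S
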